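{- Let $n\ge 2$ be an integer and let $N$ be an integer with $N \ge \frac74 n + 10$. Then $P_N^3 \to (\mathcal{C}_{\le 5}, P_n)$; that is, for every coloring of the edges of $P_N^3$ with red and blue in which there is no red cycle of length $3$, $4$ or $5$, there is a blue path on $n$ vertices.
   Context: $P_n$ denotes the path on $n$ vertices. For a graph $G$, $G^k$ is the graph on $V(G)$ in which two vertices are adjacent iff their distance in $G$ is at most $k$; thus $P_N^3$ is the graph on vertex set $\{1,\dots,N\}$ with $i\sim j$ iff $1\le |i-j|\le 3$. For a family of graphs $\mathcal{F}$ and a graph $H$, $G\to(\mathcal{F},H)$ means that every red/blue coloring of $E(G)$ contains a red copy of some graph in $\mathcal{F}$ or a blue copy of $H$. $\mathcal{C}_{\le m}$ denotes the family of all cycles of length at most $m$. -}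

module Defs where

open import Data.Nat using (ℕ; zero; suc; _≤_; _∸_; ∣_-_∣)
open import Data.Fin using (Fin; toℕ)
open import Data.Product using (_×_; Σ; ∃-syntax)
open import Data.Sum using (_⊎_)
open import Relation.Binary.PropositionalEquality using (_≡_)
open import Function.Definitions using (Injective)

data Colour : Set where
  red blue : Colour

-- Adjacency in P_N^3 on vertex set Fin N (vertices 0..N-1, a relabelling of 1..N):
-- i ~ j iff 1 ≤ |i - j| ≤ 3.
Adj : {N : ℕ} → Fin N → Fin N → Set
Adj i j = (1 ≤ ∣ toℕ i - toℕ j ∣) × (∣ toℕ i - toℕ j ∣ ≤ 3)

-- A red/blue colouring of the edges of P_N^3: a symmetric function on vertex
-- pairs (its values on non-adjacent pairs are irrelevant).
record Colouring (N : ℕ) : Set where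
  field
    col : Fin N → Fin N → Colour
    sym : ∀ i j → col i j ≡ col j i
open Colouring public

ColEdge : {N : ℕ} → Colouring N → Colour → Fin N → Fin N → Set
ColEdge c κ u v = Adj u v × (col c u v ≡ κ)

MonoPath : {N : ℕ} → Colouring N → Colour → ℕ → Set
MonoPath {N} c κ n =
  Σ (Fin n → Fin N) λ v →
    Injective _≡_ _≡_ v ×
    (∀ (i j : Fin n) → toℕ j ≡ suc (toℕ i) → ColEdge c κ (v i) (v j))

MonoCycle : {N : ℕ} → Colouring N → Colour → ℕ → Set
MonoCycle {N} c κ k =
  Σ (Fin k → Fin N) λ v →
    Injective _≡_ _≡_ v ×
    (∀ (i j : Fin k) →
       (toℕ j ≡ suc (toℕ i)) ⊎ ((toℕ i ≡ k ∸ 1) × (toℕ j ≡ 0)) →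
       ColEdge c κ (v i) (v j))

HasRedShortCycle : {N : ℕ} → Colouring N → Set
HasRedShortCycle c = ∃[ k ] (3 ≤ k) × (k ≤ 5) × MonoCycle c red k

{-# OPTIONS --safe #-}
module Submission where

-- Grow a blue path to the right, keeping its end e its largest vertex. What
-- matters about e is which of its edges to e+1, e+2, e+3 are blue; to each of
-- five such patterns, together covering every e that is not a dead end, a debt
-- is attached. A finite case analysis on the colours of the edges among
-- e, ..., e+9 either exhibits a red cycle of length at most 5 or prolongs the
-- path by k vertices to an end e+x with 4x + (new debt) ≤ 7k + (old debt).
-- Hence 4e + debt ≤ 7 · (number of vertices of the path) is an invariant, and
-- once e has come within 9 of N the path has at least n vertices.

open import Defs
open import Data.Fin using (Fin; zero; suc; toℕ; inject≤)
open import Data.Fin.Properties using (toℕ-fromℕ<; toℕ-inject≤; inject≤-injective)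
open import Data.List using (List; []; _∷_; _++_; length; lookup; map)
open import Data.List.Membership.Propositional.Properties using (∈-lookup)
open import Data.List.Properties using (length-++; length-map; map-++)
open import Data.List.Relation.Unary.All as All using (All; []; _∷_; all?)
import Data.List.Relation.Unary.All.Properties as All
open import Data.List.Relation.Unary.AllPairs using ([]; _∷_)
open import Data.List.Relation.Unary.Linked as Linked using (Linked; []; [-]; _∷_; linked?)
import Data.List.Relation.Unary.Linked.Properties as Linked
open import Data.List.Relation.Unary.Unique.Propositional using (Unique)
import Data.List.Relation.Unary.Unique.Propositional.Properties as Unique
open import Data.Nat using (ℕ; zero; suc; _≤_; _<_; _*_; _+_; ∣_-_∣; z≤n; s≤s; NonZero; _≤?_; >-nonZero)
open import Data.Nat.DivMod using (_mod_; m<n⇒m%n≡m; m%n<n)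
open import Data.Nat.Properties
open import Data.List.Relation.Unary.Unique.DecPropositional _≟_ using (unique?)
open import Data.Nat.Tactic.RingSolver using (solve-∀)
open import Data.Product using (_×_; _,_; ∃-syntax; proj₁)
open import Data.Product.Properties using (≡-dec)
open import Data.Sum using (_⊎_; inj₁; inj₂; [_,_]′)
open import Function using (_$_)
open import Relation.Binary.Definitions using (DecidableEquality)
open import Relation.Binary.PropositionalEquality using (_≡_; refl; trans; cong; subst; subst₂) renaming (sym to ≡-sym)
open import Relation.Nullary using (Dec; yes; no; contradiction)
open import Relation.Nullary.Decidable using (True; toWitness; _×-dec_; _⊎-dec_)

-- Lookup in lists and chains of related entries.

module _ {A : Set} where

  lookup-injective : {xs : List A} → Unique xs → ∀ i j → lookup xs i ≡ lookup xs j → i ≡ j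
  lookup-injective (_  ∷ _) zero    zero    _  = refl
  lookup-injective (x∉ ∷ _) zero    (suc j) eq = contradiction eq (All.lookup x∉ (∈-lookup j))
  lookup-injective (x∉ ∷ _) (suc i) zero    eq = contradiction (≡-sym eq) (All.lookup x∉ (∈-lookup i))
  lookup-injective (_  ∷ u) (suc i) (suc j) eq = cong suc (lookup-injective u i j eq)

  lookup-All : ∀ {P : A → Set} {xs} → All P xs → ∀ i → P (lookup xs i)
  lookup-All ps i = All.lookup ps (∈-lookup i)

  module _ {R : A → A → Set} where

    lookup-linked : ∀ {xs} → Linked R xs → ∀ i j → toℕ j ≡ suc (toℕ i) → R (lookup xs i) (lookup xs j)
    lookup-linked (r ∷ _)  zero    (suc zero) _  = r
    lookup-linked (_ ∷ rs) (suc i) (suc j)    eq = lookup-linked rs i j (suc-injective eq)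
    lookup-linked [-]      zero    zero       ()

    linked-init : ∀ xs {ys} → Linked R (xs ++ ys) → Linked R xs
    linked-init []           _        = []
    linked-init (_ ∷ [])     _        = [-]
    linked-init (_ ∷ y ∷ xs) (r ∷ rs) = r ∷ linked-init (y ∷ xs) rs

    linked-last : ∀ xs {y} → Linked R (xs ++ y ∷ []) → ∀ i → suc (toℕ i) ≡ length xs → R (lookup xs i) y
    linked-last (_ ∷ [])     (r ∷ _)  zero    _  = r
    linked-last (_ ∷ _ ∷ xs) (_ ∷ rs) (suc i) eq = linked-last (_ ∷ xs) rs i (suc-injective eq)

    -- The shared entry `y` is the old end of the blue path, where a new segment is attached.
    linked-glue : ∀ xs {y ys} → Linked R (xs ++ y ∷ []) → Linked R (y ∷ ys) → Linked R (xs ++ y ∷ ys)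
    linked-glue []           _        ss = ss
    linked-glue (_ ∷ [])     (r ∷ _)  ss = r ∷ ss
    linked-glue (_ ∷ z ∷ xs) (r ∷ rs) ss = r ∷ linked-glue (z ∷ xs) rs ss

-- Local information about edge colours.

Near : ℕ → ℕ → Set
Near i j = 1 ≤ ∣ i - j ∣ × ∣ i - j ∣ ≤ 3

near? : ∀ i j → Dec (Near i j)
near? i j = (1 ≤? ∣ i - j ∣) ×-dec (∣ i - j ∣ ≤? 3)

near-shift : ∀ e {i j} → Near i j → Near (e + i) (e + j)
near-shift e {i} {j} = subst (λ d → 1 ≤ d × d ≤ 3) (≡-sym (∣m+n-m+o∣≡∣n-o∣ e i j))

_≟ᶜ_ : DecidableEquality Colour
red  ≟ᶜ red  = yes refl
red  ≟ᶜ blue = no λ ()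
blue ≟ᶜ red  = no λ ()
blue ≟ᶜ blue = yes refl

-- (i , j , k) records that the edge between the vertices at offsets i and j
-- from a base vertex has colour k.
Fact : Set
Fact = ℕ × ℕ × Colour

open import Data.List.Membership.DecPropositional (≡-dec _≟_ (≡-dec _≟_ _≟ᶜ_)) using (_∈_; _∈?_)

-- Colourings are symmetric, so a fact may be read in both directions although `ask` records only
-- one.
Known : List Fact → Fact → Set
Known K (i , j , k) = (i , j , k) ∈ K ⊎ (j , i , k) ∈ K

known? : ∀ K f → Dec (Known K f)
known? K (i , j , k) = ((i , j , k) ∈? K) ⊎-dec ((j , i , k) ∈? K)

KnownEdge : List Fact → Colour → ℕ → ℕ → Set
KnownEdge K k i j = Near i j × Known K (i , j , k)

knownEdge? : ∀ K k i j → Dec (KnownEdge K k i j)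
knownEdge? K k i j = near? i j ×-dec known? K (i , j , k)

shift : ℕ → Fact → Fact
shift e (i , j , k) = e + i , e + j , k

-- What is known about the edges from the end e of the path to e+1, e+2, e+3:
-- the letters are the colours in this order, ∗ stands for an unknown colour.
data Status : Set where
  bb∗ b∗r ∗b∗ b∗∗ ∗∗b : Status

facts : Status → List Fact
facts bb∗ = (0 , 1 , blue) ∷ (0 , 2 , blue) ∷ []
facts b∗r = (0 , 1 , blue) ∷ (0 , 3 , red) ∷ []
facts ∗b∗ = (0 , 2 , blue) ∷ []
facts b∗∗ = (0 , 1 , blue) ∷ []
facts ∗∗b = (0 , 3 , blue) ∷ []

-- These values come from a computer solution of the game in which an opponent
-- colours the edges and each step scores 7k - 4x.
debt : Status → ℕ
debt bb∗ = 0
debt b∗r = 0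
debt ∗b∗ = 3
debt b∗∗ = 3
debt ∗∗b = 8

-- Decision trees and the certificates at their leaves.

ShortCycle : List Fact → ℕ → List ℕ → Set
ShortCycle K x xs =
  -- The cycle has one vertex more than `xs`, hence 3 to 5.
  2 ≤ length xs × length xs ≤ 4 × Unique (x ∷ xs) × All (_≤ 9) (x ∷ xs) ×
  Linked (KnownEdge K red) (x ∷ xs ++ x ∷ [])

-- Decidability lets the type checker verify each leaf of a `Plan` by evaluation, through an
-- implicit `True` argument.
shortCycle? : ∀ K x xs → Dec (ShortCycle K x xs)
shortCycle? K x xs =
  (2 ≤? length xs) ×-dec (length xs ≤? 4) ×-dec unique? (x ∷ xs) ×-dec all? (_≤? 9) (x ∷ xs) ×-dec
  linked? (knownEdge? K red) (x ∷ xs ++ x ∷ [])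

-- The path, of current end 0, is prolonged to the new end x; the list x ∷ xs
-- runs backwards along the path.
Advance : List Fact → ℕ → ℕ → List ℕ → Status → Set
Advance K d x xs s =
  4 * x + debt s ≤ 7 * length (x ∷ xs) + d ×
  Unique (x ∷ xs) × All (λ y → 1 ≤ y × y ≤ x) (x ∷ xs) × x ≤ 9 ×
  Linked (KnownEdge K blue) (x ∷ xs ++ 0 ∷ []) ×
  All (λ f → Known K (shift x f)) (facts s)

advance? : ∀ K d x xs s → Dec (Advance K d x xs s)
advance? K d x xs s =
  (4 * x + debt s ≤? 7 * length (x ∷ xs) + d) ×-dec
  unique? (x ∷ xs) ×-dec all? (λ y → (1 ≤? y) ×-dec (y ≤? x)) (x ∷ xs) ×-dec (x ≤? 9) ×-dec
  linked? (knownEdge? K blue) (x ∷ xs ++ 0 ∷ []) ×-dec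
  all? (λ f → known? K (shift x f)) (facts s)

-- Plan d K is a decision tree for a path of end 0 and debt d when K is known:
-- ask i j reveals the colour of an edge, with the red subtree first.
data Plan : ℕ → List Fact → Set where
  ask   : ∀ {d K} i j → Plan d ((i , j , red) ∷ K) → Plan d ((i , j , blue) ∷ K) → Plan d K
  cycle : ∀ {d K} x xs {_ : True (shortCycle? K x xs)} → Plan d K
  go    : ∀ {d K} x xs s {_ : True (advance? K d x xs s)} → Plan d K
  reuse : ∀ {d d′ K K′} → Plan d′ K′ → {_ : True (all? (known? K) K′)} {_ : True (d′ ≤? d)} → Plan d K

-- The five decision trees.

plan-bb∗ : Plan (debt bb∗) (facts bb∗)
plan-bb∗ =
  -- A blue `1 2` or `1 3` makes the move to 1 just affordable: 4 + 3 = 7. Otherwise the path leaves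
  -- 0 through 2, or through 1 and then 4.
  ask 1 2
    (ask 2 3
       (ask 1 3 (cycle 1 (2 ∷ 3 ∷ [])) (go 1 [] ∗b∗)) $
     ask 3 4
       (ask 1 4
          (ask 1 3 (cycle 1 (3 ∷ 4 ∷ [])) (go 1 [] ∗b∗)) $
        ask 2 4
          (ask 1 3 (cycle 1 (2 ∷ 4 ∷ 3 ∷ [])) (go 1 [] ∗b∗)) $
        ask 1 3
          (ask 5 6
             (ask 5 7
                (ask 3 6
                   (ask 6 7 (cycle 5 (6 ∷ 7 ∷ [])) $
                    ask 4 6 (cycle 3 (4 ∷ 6 ∷ [])) $
                    ask 4 5 (cycle 3 (4 ∷ 5 ∷ 6 ∷ [])) $
                    ask 2 5 (cycle 1 (2 ∷ 5 ∷ 6 ∷ 3 ∷ [])) (go 6 (4 ∷ 5 ∷ 2 ∷ []) b∗∗)) $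
                 ask 6 7 (cycle 5 (6 ∷ 7 ∷ [])) (go 6 (3 ∷ 2 ∷ 4 ∷ 1 ∷ []) b∗∗)) $
              ask 3 5
                (ask 2 5 (cycle 1 (2 ∷ 5 ∷ 3 ∷ [])) (go 5 (2 ∷ 4 ∷ 1 ∷ []) ∗b∗))
                (go 5 (3 ∷ 2 ∷ 4 ∷ 1 ∷ []) ∗b∗)) $
           ask 3 5
             (ask 2 5 (cycle 1 (2 ∷ 5 ∷ 3 ∷ [])) (go 5 (2 ∷ 4 ∷ 1 ∷ []) b∗∗))
             (go 5 (3 ∷ 2 ∷ 4 ∷ 1 ∷ []) b∗∗))
          (go 1 [] ∗b∗)) $
     ask 3 5
       (ask 4 5
          (ask 1 3
             (ask 5 6
                (ask 4 6 (cycle 4 (5 ∷ 6 ∷ [])) (go 4 (3 ∷ 2 ∷ []) ∗b∗)) $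
              ask 2 5 (cycle 1 (2 ∷ 5 ∷ 3 ∷ [])) $
              ask 1 4 (cycle 1 (3 ∷ 5 ∷ 4 ∷ [])) (go 5 (2 ∷ 3 ∷ 4 ∷ 1 ∷ []) b∗∗))
             (go 1 [] ∗b∗))
          (go 4 (3 ∷ 2 ∷ []) b∗∗))
       (go 3 (2 ∷ []) bb∗))
    (go 1 [] b∗∗)

-- As `0 3` is red, the edges `0 2`, `2 1`, `1 3` cannot all be red. So either `bb∗` applies, or 1
-- has a blue edge to 2 or 3 and can be the new end.
plan-b∗r : Plan (debt b∗r) (facts b∗r)
plan-b∗r =
  ask 0 2
    (ask 1 2
       (ask 1 3 (cycle 0 (2 ∷ 1 ∷ 3 ∷ [])) (go 1 [] ∗b∗))
       (go 1 [] b∗∗))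
    (reuse plan-bb∗)

plan-∗b∗ : Plan (debt ∗b∗) (facts ∗b∗)
plan-∗b∗ =
  ask 0 1
    (ask 2 3
       (ask 1 4
          (ask 2 4
             (ask 3 4 (cycle 2 (3 ∷ 4 ∷ [])) $
              ask 1 3 (cycle 1 (3 ∷ 2 ∷ 4 ∷ [])) $
              ask 1 2 (cycle 1 (2 ∷ 4 ∷ [])) (go 3 (1 ∷ 2 ∷ []) b∗∗)) $
           ask 4 5
             (ask 3 4
                (ask 3 5 (cycle 3 (4 ∷ 5 ∷ [])) $
                 ask 1 3 (cycle 1 (3 ∷ 4 ∷ [])) $
                 ask 1 2 (cycle 1 (2 ∷ 3 ∷ 4 ∷ [])) (go 3 (1 ∷ 2 ∷ []) ∗b∗)) $
              ask 3 5
                (ask 1 3 (cycle 1 (3 ∷ 5 ∷ 4 ∷ [])) $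
                 ask 1 2 (cycle 1 (2 ∷ 3 ∷ 5 ∷ 4 ∷ [])) (go 3 (1 ∷ 2 ∷ []) b∗∗)) $
              ask 5 6
                (ask 6 7
                   (ask 5 7 (cycle 5 (6 ∷ 7 ∷ [])) (go 5 (3 ∷ 4 ∷ 2 ∷ []) ∗b∗)) $
                 ask 2 5
                   (ask 3 6 (cycle 2 (3 ∷ 6 ∷ 5 ∷ [])) (go 6 (3 ∷ 4 ∷ 2 ∷ []) b∗∗)) $
                 ask 4 6 (cycle 4 (5 ∷ 6 ∷ [])) (go 6 (4 ∷ 3 ∷ 5 ∷ 2 ∷ []) b∗∗))
                (go 5 (3 ∷ 4 ∷ 2 ∷ []) b∗∗)) $
           ask 4 6
             (ask 5 6
                (ask 3 6
                   (ask 3 4 (cycle 3 (4 ∷ 6 ∷ [])) $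
                    ask 1 3 (cycle 1 (3 ∷ 6 ∷ 4 ∷ [])) $
                    ask 1 2 (cycle 1 (2 ∷ 3 ∷ 6 ∷ 4 ∷ [])) (go 3 (1 ∷ 2 ∷ []) b∗∗)) $
                 ask 6 7
                   (ask 5 7 (cycle 5 (6 ∷ 7 ∷ [])) (go 5 (4 ∷ 2 ∷ []) ∗b∗)) $
                 ask 3 5
                   (ask 3 4 (cycle 3 (4 ∷ 6 ∷ 5 ∷ [])) (go 6 (3 ∷ 4 ∷ 2 ∷ []) b∗∗))
                   (go 6 (3 ∷ 5 ∷ 4 ∷ 2 ∷ []) b∗∗))
                (go 5 (4 ∷ 2 ∷ []) b∗∗))
             (go 4 (2 ∷ []) bb∗)) $
        -- As `1 4` is blue, both colours lead to 4: by 0, 2, 1, 4 if `1 2` is blue, and by 0, 3, 1,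
        -- 4 if it is red, since a red `1 3` or `0 3` would close a short cycle. If 4 is a dead end,
        -- `5 6` and `6 7` are blue and the path is led to 5 or 6 instead.
        ask 1 2
          (ask 4 5
             (ask 4 6
                (ask 4 7
                   (ask 2 4
                      (ask 6 7 (cycle 4 (6 ∷ 7 ∷ [])) $
                       ask 3 6 (cycle 2 (3 ∷ 6 ∷ 4 ∷ [])) $
                       ask 3 5 (cycle 2 (3 ∷ 5 ∷ 4 ∷ [])) $
                       ask 2 5 (cycle 2 (4 ∷ 5 ∷ [])) (go 6 (3 ∷ 5 ∷ 2 ∷ []) b∗∗)) $
                    ask 3 5
                      (ask 6 7 (cycle 4 (6 ∷ 7 ∷ [])) $
                       ask 3 6 (cycle 3 (5 ∷ 4 ∷ 6 ∷ [])) $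
                       ask 3 4 (cycle 3 (4 ∷ 5 ∷ [])) (go 6 (3 ∷ 4 ∷ 2 ∷ []) b∗∗)) $
                    ask 5 6 (cycle 4 (5 ∷ 6 ∷ [])) $
                    ask 1 3 (cycle 1 (2 ∷ 3 ∷ [])) (go 5 (3 ∷ 1 ∷ 4 ∷ 2 ∷ []) b∗∗)) $
                 ask 1 3 (cycle 1 (2 ∷ 3 ∷ [])) $
                 ask 0 3 (cycle 0 (1 ∷ 2 ∷ 3 ∷ [])) (go 4 (1 ∷ 3 ∷ []) ∗∗b)) $
              ask 1 3 (cycle 1 (2 ∷ 3 ∷ [])) $
              ask 0 3 (cycle 0 (1 ∷ 2 ∷ 3 ∷ [])) (go 4 (1 ∷ 3 ∷ []) ∗b∗)) $
           ask 1 3 (cycle 1 (2 ∷ 3 ∷ [])) $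
           ask 0 3 (cycle 0 (1 ∷ 2 ∷ 3 ∷ [])) (go 4 (1 ∷ 3 ∷ []) b∗∗)) $
        ask 4 5
          (ask 4 6
             (ask 4 7
                (ask 3 4
                   (ask 6 7 (cycle 4 (6 ∷ 7 ∷ [])) $
                    ask 3 6 (cycle 3 (4 ∷ 6 ∷ [])) $
                    ask 3 5 (cycle 3 (4 ∷ 5 ∷ [])) $
                    ask 2 5 (cycle 2 (3 ∷ 4 ∷ 5 ∷ [])) (go 6 (3 ∷ 5 ∷ 2 ∷ []) b∗∗)) $
                 ask 3 5
                   (ask 6 7 (cycle 4 (6 ∷ 7 ∷ [])) $
                    ask 3 6 (cycle 3 (5 ∷ 4 ∷ 6 ∷ [])) (go 6 (3 ∷ 4 ∷ 1 ∷ 2 ∷ []) b∗∗)) $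
                 ask 5 6 (cycle 4 (5 ∷ 6 ∷ [])) (go 5 (3 ∷ 4 ∷ 1 ∷ 2 ∷ []) b∗∗))
                (go 4 (1 ∷ 2 ∷ []) ∗∗b))
             (go 4 (1 ∷ 2 ∷ []) ∗b∗))
          (go 4 (1 ∷ 2 ∷ []) b∗∗)) $
     -- The status `b∗r` is made for this move: 8 + 0 ≤ 7 + 3, whereas the debt 3 of `b∗∗` would be
     -- too much.
     ask 2 5 (go 2 [] b∗r) $
     ask 3 4
       (ask 3 5
          (ask 0 3
             (ask 4 5 (cycle 3 (4 ∷ 5 ∷ [])) $
              ask 1 4 (cycle 0 (1 ∷ 4 ∷ 3 ∷ [])) $
              ask 1 3 (cycle 0 (1 ∷ 3 ∷ [])) (go 4 (1 ∷ 3 ∷ 2 ∷ []) b∗∗)) $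
           ask 5 6
             (ask 6 7
                (ask 5 7 (cycle 5 (6 ∷ 7 ∷ [])) (go 5 (2 ∷ 3 ∷ []) ∗b∗)) $
              ask 4 6 (cycle 3 (4 ∷ 6 ∷ 5 ∷ [])) $
              ask 4 5 (cycle 3 (4 ∷ 5 ∷ [])) (go 6 (4 ∷ 5 ∷ 2 ∷ []) b∗∗))
             (go 5 (2 ∷ 3 ∷ []) b∗∗))
          (go 3 (2 ∷ []) ∗b∗))
       (go 3 (2 ∷ []) b∗∗))
    (reuse plan-bb∗)

-- Unless `b∗r` applies or 1 has a blue edge to 2 or 3, both `0 1` and `0 3` are blue while `1 2`
-- and `1 3` are red. Then `2 3` is blue, and the path can leave 0 through 1 or through 3 and 2.
plan-b∗∗ : Plan (debt b∗∗) (facts b∗∗)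
plan-b∗∗ =
  ask 0 3 (reuse plan-b∗r) $
  ask 1 3
    (ask 1 2
       (ask 4 5
          (ask 5 6
             (ask 2 4
                (ask 5 7
                   (ask 6 8
                      (ask 5 8 (cycle 5 (6 ∷ 8 ∷ [])) $
                       ask 3 5 (cycle 1 (2 ∷ 4 ∷ 5 ∷ 3 ∷ [])) $
                       ask 3 4 (cycle 1 (2 ∷ 4 ∷ 3 ∷ [])) $
                       ask 1 4 (cycle 1 (2 ∷ 4 ∷ [])) (go 5 (3 ∷ 4 ∷ 1 ∷ []) ∗∗b)) $
                    ask 6 7 (cycle 5 (6 ∷ 7 ∷ [])) $
                    ask 4 6 (cycle 4 (5 ∷ 6 ∷ [])) $
                    ask 1 4 (cycle 1 (2 ∷ 4 ∷ [])) (go 6 (4 ∷ 1 ∷ []) bb∗)) $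
                 ask 2 5 (cycle 2 (4 ∷ 5 ∷ [])) $
                 ask 2 3 (cycle 1 (2 ∷ 3 ∷ [])) (go 5 (2 ∷ 3 ∷ []) ∗b∗)) $
              ask 4 6 (cycle 4 (5 ∷ 6 ∷ [])) $
              ask 2 3 (cycle 1 (2 ∷ 3 ∷ [])) (go 4 (2 ∷ 3 ∷ []) ∗b∗)) $
           ask 2 5
             (ask 3 5 (cycle 1 (2 ∷ 5 ∷ 3 ∷ [])) $
              ask 3 4 (cycle 1 (2 ∷ 5 ∷ 4 ∷ 3 ∷ [])) $
              ask 1 4 (cycle 1 (2 ∷ 5 ∷ 4 ∷ [])) (go 5 (3 ∷ 4 ∷ 1 ∷ []) b∗∗)) $
           ask 2 3 (cycle 1 (2 ∷ 3 ∷ [])) (go 5 (2 ∷ 3 ∷ []) b∗∗)) $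
        ask 1 4
          (ask 2 4 (cycle 1 (2 ∷ 4 ∷ [])) $
           ask 2 3 (cycle 1 (2 ∷ 3 ∷ [])) (go 4 (2 ∷ 3 ∷ []) b∗∗)) $
        ask 2 4
          (ask 5 6
             (ask 5 7
                (ask 4 6
                   (ask 6 7 (cycle 5 (6 ∷ 7 ∷ [])) $
                    ask 3 6 (cycle 1 (2 ∷ 4 ∷ 6 ∷ 3 ∷ [])) $
                    ask 3 4 (cycle 1 (2 ∷ 4 ∷ 3 ∷ [])) (go 6 (3 ∷ 4 ∷ 1 ∷ []) b∗∗))
                   (go 4 (1 ∷ []) bb∗))
                (go 5 (4 ∷ 1 ∷ []) ∗b∗))
             (go 5 (4 ∷ 1 ∷ []) b∗∗)) $
        ask 2 3 (cycle 1 (2 ∷ 3 ∷ [])) (go 4 (2 ∷ 3 ∷ []) b∗∗))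
       (go 1 [] b∗∗))
    (go 1 [] ∗b∗)

-- The debt 8 just pays for a jump to 3: 12 + 3 = 7 + 8. If `3 4` and `3 5` are red, then `4 5` is
-- blue, and red cycles through 0, 1, 2 are avoided only if the path can turn back from 3 to 1 or 2
-- and go on to 4.
plan-∗∗b : Plan (debt ∗∗b) (facts ∗∗b)
plan-∗∗b =
  ask 0 1
    (ask 0 2
       (ask 3 4
          (ask 3 5
             (ask 1 3
                (ask 4 5 (cycle 3 (4 ∷ 5 ∷ [])) $
                 ask 2 4 (cycle 0 (1 ∷ 3 ∷ 4 ∷ 2 ∷ [])) $
                 ask 2 3 (cycle 0 (1 ∷ 3 ∷ 2 ∷ [])) (go 4 (2 ∷ 3 ∷ []) b∗∗)) $
              ask 1 4
                (ask 4 5 (cycle 3 (4 ∷ 5 ∷ [])) $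
                 ask 2 4 (cycle 0 (1 ∷ 4 ∷ 2 ∷ [])) $
                 ask 2 3 (cycle 0 (1 ∷ 4 ∷ 3 ∷ 2 ∷ [])) (go 4 (2 ∷ 3 ∷ []) b∗∗)) $
              ask 4 5 (cycle 3 (4 ∷ 5 ∷ [])) (go 4 (1 ∷ 3 ∷ []) b∗∗))
             (go 3 [] ∗b∗))
          (go 3 [] b∗∗))
       (reuse plan-∗b∗))
    (reuse plan-b∗∗)

plan : ∀ s → Plan (debt s) (facts s)
plan bb∗ = plan-bb∗
plan b∗r = plan-b∗r
plan ∗b∗ = plan-∗b∗
plan b∗∗ = plan-b∗∗
plan ∗∗b = plan-∗∗b

-- Adding the two inequalities puts the old debt `d` on both sides, where it cancels.
budget : ∀ e x t d a b → 4 * e + d ≤ 7 * a → 4 * x + t ≤ 7 * b + d → 4 * (e + x) + t ≤ 7 * (b + a)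
budget e x t d a b p q = +-cancelʳ-≤ d _ _ $ begin
  4 * (e + x) + t + d       ≡⟨ regroupˡ e x t d ⟩
  (4 * e + d) + (4 * x + t) ≤⟨ +-mono-≤ p q ⟩
  7 * a + (7 * b + d)       ≡⟨ regroupʳ a b d ⟩
  7 * (b + a) + d           ∎
  where
  open ≤-Reasoning
  regroupˡ : ∀ e x t d → 4 * (e + x) + t + d ≡ (4 * e + d) + (4 * x + t)
  regroupˡ = solve-∀
  regroupʳ : ∀ a b d → 7 * a + (7 * b + d) ≡ 7 * (b + a) + d
  regroupʳ = solve-∀

-- From offsets to vertices of the coloured graph.

module _ {N : ℕ} .{{_ : NonZero N}} (c : Colouring N) where

  -- Reduction modulo N only serves to make this total.
  vertex : ℕ → Fin N
  vertex i = i mod N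

  toℕ-vertex : ∀ {i} → i < N → toℕ (vertex i) ≡ i
  toℕ-vertex {i} i<N = trans (toℕ-fromℕ< (m%n<n i N)) (m<n⇒m%n≡m i<N)

  hue : ℕ → ℕ → Colour
  hue i j = col c (vertex i) (vertex j)

  red-or-blue : ∀ i j → hue i j ≡ red ⊎ hue i j ≡ blue
  red-or-blue i j with hue i j
  ... | red  = inj₁ refl
  ... | blue = inj₂ refl

  Edge : Colour → ℕ → ℕ → Set
  Edge k i j = Near i j × hue i j ≡ k

  colEdge : ∀ {k i j} → i < N → j < N → Edge k i j → ColEdge c k (vertex i) (vertex j)
  colEdge i<N j<N (near , eq) =
    subst₂ Near (≡-sym (toℕ-vertex i<N)) (≡-sym (toℕ-vertex j<N)) near , eq

  vertex-injective : ∀ {i j} → i < N → j < N → vertex i ≡ vertex j → i ≡ j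
  vertex-injective i<N j<N eq =
    trans (≡-sym (toℕ-vertex i<N)) (trans (cong toℕ eq) (toℕ-vertex j<N))

  path : ∀ {k n} xs → All (_< N) xs → Unique xs → Linked (Edge k) xs → n ≤ length xs → MonoPath c k n
  path xs below unique linked n≤ =
    -- The list may be longer than `n`; its first `n` entries are taken.
    (λ i → vertex (lookup xs (inject≤ i n≤))) ,
    (λ eq → inject≤-injective n≤ n≤ _ _
      (lookup-injective unique _ _ (vertex-injective (lookup-All below _) (lookup-All below _) eq))) ,
    λ i j eq → colEdge (lookup-All below _) (lookup-All below _)
      (lookup-linked linked _ _
        (trans (toℕ-inject≤ j n≤) (trans eq (cong suc (≡-sym (toℕ-inject≤ i n≤))))))

  closedPath : ∀ {k} x xs → All (_< N) (x ∷ xs) → Unique (x ∷ xs) → Linked (Edge k) (x ∷ xs ++ x ∷ []) →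
               MonoCycle c k (length (x ∷ xs))
  closedPath x xs below unique linked =
    (λ i → vertex (lookup (x ∷ xs) i)) ,
    (λ {i} {j} eq → lookup-injective unique i j (vertex-injective (lookup-All below i) (lookup-All below j) eq)) ,
    λ where
      i j (inj₁ eq) → colEdge (lookup-All below i) (lookup-All below j)
        (lookup-linked (linked-init (x ∷ xs) linked) i j eq)
      i zero (inj₂ (eq , _)) → colEdge (lookup-All below i) (lookup-All below zero)
        (linked-last (x ∷ xs) linked i (cong suc eq))

  Holds : ℕ → Fact → Set
  Holds e (i , j , k) = hue (e + i) (e + j) ≡ k

  known-holds : ∀ {e K} → All (Holds e) K → ∀ f → Known K f → Holds e f
  known-holds hs (i , j , k) (inj₁ f∈) = All.lookup hs f∈
  known-holds {e} hs (i , j , k) (inj₂ f∈) =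
    trans (Colouring.sym c (vertex (e + i)) (vertex (e + j))) (All.lookup hs f∈)

  known-edges : ∀ {e K k xs} → All (Holds e) K → Linked (KnownEdge K k) xs → Linked (Edge k) (map (e +_) xs)
  known-edges {e} hs linked =
    Linked.map⁺ (Linked.map (λ { {i} {j} (near , known) → near-shift e near , known-holds hs _ known }) linked)

  shift-holds : ∀ {e x} f → Holds e (shift x f) → Holds (e + x) f
  shift-holds {e} {x} (i , j , k) h rewrite +-assoc e x i | +-assoc e x j = h

  -- Running a decision tree on the actual colouring.

  Prolongation : ℕ → ℕ → Set
  Prolongation e d = ∃[ x ] ∃[ xs ] ∃[ s ]
    4 * x + debt s ≤ 7 * length (x ∷ xs) + d ×
    Unique (x ∷ xs) × All (λ y → 1 ≤ y × y ≤ x) (x ∷ xs) × x ≤ 9 ×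
    Linked (Edge blue) (map (e +_) (x ∷ xs ++ 0 ∷ [])) ×
    All (Holds (e + x)) (facts s)

  redCycle : ∀ {e K} → e + 9 < N → All (Holds e) K → ∀ x xs → ShortCycle K x xs → HasRedShortCycle c
  redCycle {e} e+9<N hs x xs (3≤ , ≤5 , unique , bounded , linked) =
    length (map (e +_) (x ∷ xs)) ,
    subst (3 ≤_) (≡-sym (length-map (e +_) (x ∷ xs))) (s≤s 3≤) ,
    subst (_≤ 5) (≡-sym (length-map (e +_) (x ∷ xs))) (s≤s ≤5) ,
    closedPath (e + x) (map (e +_) xs)
      (All.map⁺ (All.map (λ y≤9 → ≤-<-trans (+-monoʳ-≤ e y≤9) e+9<N) bounded))
      (Unique.map⁺ (+-cancelˡ-≡ e _ _) unique)
      (subst (Linked (Edge red)) (map-++ (e +_) (x ∷ xs) (x ∷ [])) (known-edges hs linked))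

  -- The colouring selects a branch at each `ask`, and the facts collected on the way are true of
  -- it, so the certificate at the leaf becomes a statement about the graph.
  follow : ∀ {e d K} → e + 9 < N → All (Holds e) K → Plan d K → HasRedShortCycle c ⊎ Prolongation e d
  follow {e} e+9<N hs (ask i j p q) with hue (e + i) (e + j) in eq
  ... | red  = follow e+9<N (eq ∷ hs) p
  ... | blue = follow e+9<N (eq ∷ hs) q
  follow e+9<N hs (cycle x xs {valid}) = inj₁ (redCycle e+9<N hs x xs (toWitness valid))
  follow {e} e+9<N hs (go x xs s {valid}) with toWitness valid
  ... | gain , unique , bounded , x≤9 , linked , known =
    inj₂ (x , xs , s , gain , unique , bounded , x≤9 , known-edges hs linked ,
          All.map (λ {f} k → shift-holds {e} {x} f (known-holds hs (shift x f) k)) known)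
  follow e+9<N hs (reuse p {K⊇} {d≥}) with follow e+9<N (All.map (known-holds hs _) (toWitness K⊇)) p
  ... | inj₁ cyc = inj₁ cyc
  ... | inj₂ (x , xs , s , gain , rest) =
    inj₂ (x , xs , s , ≤-trans gain (+-monoʳ-≤ (7 * length (x ∷ xs)) (toWitness d≥)) , rest)

  -- Growth of the blue path.

  record BluePath (e : ℕ) (xs : List ℕ) : Set where
    constructor bluePath
    field
      bounded : All (_≤ e) (e ∷ xs)
      unique  : Unique (e ∷ xs)
      linked  : Linked (Edge blue) (e ∷ xs)

  prolong : ∀ {e xs} x ys → BluePath e xs → Unique (x ∷ ys) → All (λ y → 1 ≤ y × y ≤ x) (x ∷ ys) →
            Linked (Edge blue) (map (e +_) (x ∷ ys ++ 0 ∷ [])) → BluePath (e + x) (map (e +_) ys ++ e ∷ xs)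
  prolong {e} {xs} x ys (bluePath bounded unique linked) uniqueʸ boundedʸ linkedʸ = bluePath
    (All.++⁺ (All.map⁺ (All.map (λ (_ , y≤x) → +-monoʳ-≤ e y≤x) boundedʸ))
             (All.map (λ z≤e → ≤-trans z≤e (m≤m+n e x)) bounded))
    (Unique.++⁺ (Unique.map⁺ (+-cancelˡ-≡ e _ _) uniqueʸ) unique
      -- New vertices exceed `e` and old ones do not.
      λ (z∈new , z∈old) → <⇒≱ (All.lookup above z∈new) (All.lookup bounded z∈old))
    (linked-glue (map (e +_) (x ∷ ys))
      -- The new segment ends in `e + 0`, which must become the `e` that heads the old path.
      (subst (λ z → Linked (Edge blue) (map (e +_) (x ∷ ys) ++ z ∷ [])) (+-identityʳ e)
        (subst (Linked (Edge blue)) (map-++ (e +_) (x ∷ ys) (0 ∷ [])) linkedʸ))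
      linked)
    where
    above : All (e <_) (map (e +_) (x ∷ ys))
    above = All.map⁺ (All.map (λ (1≤y , _) → m<m+n e 1≤y) boundedʸ)

  -- The debt is dropped from the invariant: 7l ≥ 4e ≥ 4N - 36 ≥ 7n + 4. The 40 in the bound is 4
  -- times the 10 in N ≥ 7n/4 + 10.
  long-enough : ∀ {n e t l} → 7 * n + 40 ≤ 4 * N → N ≤ e + 9 → 4 * e + t ≤ 7 * l → n ≤ l
  long-enough {n} {e} {t} {l} bound N≤ inv = *-cancelˡ-≤ 7 $ +-cancelʳ-≤ 40 _ _ $ begin
    7 * n + 40  ≤⟨ bound ⟩
    4 * N       ≤⟨ *-monoʳ-≤ 4 N≤ ⟩
    4 * (e + 9) ≡⟨ *-distribˡ-+ 4 e 9 ⟩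
    4 * e + 36  ≤⟨ +-mono-≤ (m+n≤o⇒m≤o (4 * e) inv) (m≤m+n 36 4) ⟩
    7 * l + 40  ∎
    where open ≤-Reasoning

  -- The fuel bounds the distance from the end of the path to vertex N - 9.
  march : ∀ {n} fuel {e xs} s → 7 * n + 40 ≤ 4 * N → N ≤ e + 9 + fuel → e < N →
          BluePath e xs → All (Holds e) (facts s) → 4 * e + debt s ≤ 7 * length (e ∷ xs) →
          HasRedShortCycle c ⊎ MonoPath c blue n
  march {n} fuel {e} {xs} s bound N≤ e<N p hs inv with N ≤? e + 9
  -- The window up to `e + 9` no longer fits below `N`, so no plan can be run.
  ... | yes N≤e+9 = inj₂ (path (e ∷ xs) (All.map (λ z≤e → ≤-<-trans z≤e e<N) (BluePath.bounded p))
                            (BluePath.unique p) (BluePath.linked p)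
                            (long-enough {n} {e} {debt s} bound N≤e+9 inv))
  march zero {e} s bound N≤ e<N p hs inv | no N≰ = contradiction (subst (N ≤_) (+-identityʳ (e + 9)) N≤) N≰
  march {n} (suc fuel) {e} {xs} s bound N≤ e<N p hs inv | no N≰ with follow (≰⇒> N≰) hs (plan s)
  ... | inj₁ cyc = inj₁ cyc
  ... | inj₂ (x , ys , s′ , gain , unique , bounded , x≤9 , linked , hs′) =
    march fuel s′ bound N≤′ (≤-<-trans (+-monoʳ-≤ e x≤9) (≰⇒> N≰))
      (prolong x ys p unique bounded linked) hs′
      (subst (λ l → 4 * (e + x) + debt s′ ≤ 7 * l) len
        (budget e x (debt s′) (debt s) (length (e ∷ xs)) (length (x ∷ ys)) inv gain))
    where
    len : length (x ∷ ys) + length (e ∷ xs) ≡ length (e + x ∷ map (e +_) ys ++ e ∷ xs)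
    len = ≡-sym (trans (length-++ (map (e +_) (x ∷ ys))) (cong (_+ length (e ∷ xs)) (length-map (e +_) (x ∷ ys))))
    swap : ∀ e f → e + 9 + suc f ≡ e + 1 + 9 + f
    swap = solve-∀
    N≤′ : N ≤ e + x + 9 + fuel
    N≤′ = begin
      N                ≤⟨ N≤ ⟩
      e + 9 + suc fuel ≡⟨ swap e fuel ⟩
      e + 1 + 9 + fuel ≤⟨ +-monoˡ-≤ fuel (+-monoˡ-≤ 9 (+-monoʳ-≤ e (proj₁ (All.head bounded)))) ⟩
      e + x + 9 + fuel ∎
      where open ≤-Reasoning

  single : ∀ e → BluePath e []
  single e = bluePath (≤-refl ∷ []) ([] ∷ []) [-]

-- Choice of the starting vertex.

theorem1p1 : (n N : ℕ) → 2 ≤ n → 7 * n + 40 ≤ 4 * N →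
    (c : Colouring N) → HasRedShortCycle c ⊎ MonoPath c blue n
theorem1p1 n N 2≤n bound c = start
  where
  9<N : 9 < N
  9<N = *-cancelˡ-≤ 4 (≤-trans (m≤n+m 40 (7 * n)) bound)

  instance
    N≢0 : NonZero N
    N≢0 = >-nonZero (≤-<-trans z≤n 9<N)

  -- A one-vertex path is worth 7. This covers the debt 3 at vertex 0, and exactly covers it at
  -- vertex 1, as 4 + 3 = 7.
  start-at : ∀ e s → e < N → All (Holds c e) (facts s) → 4 * e + debt s ≤ 7 → HasRedShortCycle c ⊎ MonoPath c blue n
  start-at e s e<N hs = march c N s bound (m≤n+m N (e + 9)) e<N (single c e) hs

  triangle : List Fact
  triangle = (0 , 1 , red) ∷ (1 , 2 , red) ∷ (0 , 2 , red) ∷ []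

  -- Unless 0, 1, 2 form a red triangle, one of their edges is blue and provides the first status.
  start : HasRedShortCycle c ⊎ MonoPath c blue n
  start =
    [ (λ red₀₁ →
      [ (λ red₀₂ →
        [ (λ red₁₂ →
            inj₁ (redCycle c {0} {triangle} 9<N (red₀₁ ∷ red₁₂ ∷ red₀₂ ∷ []) 0 (1 ∷ 2 ∷ [])
              (toWitness {a? = shortCycle? triangle 0 (1 ∷ 2 ∷ [])} _)))
        , (λ blue₁₂ → start-at 1 b∗∗ (≤-<-trans (m≤m+n 1 8) 9<N) (blue₁₂ ∷ []) ≤-refl)
        ]′ (red-or-blue c 1 2))
      , (λ blue₀₂ → start-at 0 ∗b∗ (≤-<-trans z≤n 9<N) (blue₀₂ ∷ []) (m≤m+n 3 4))
      ]′ (red-or-blue c 0 2))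
    , (λ blue₀₁ → start-at 0 b∗∗ (≤-<-trans z≤n 9<N) (blue₀₁ ∷ []) (m≤m+n 3 4))
    ]′ (red-or-blue c 0 1)
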